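{- Let $G$ be a finite simple quasi-line graph. Then $\chi(G) \le \Delta_2(G) + 3$.
   Context: A graph is quasi-line if for every vertex $v$, the closed neighborhood $N[v]$ is the union of two cliques (edges between the two cliques are allowed). For distinct vertices $u,v$, $\operatorname{codeg}(u,v)$ is the number of common neighbors of $u$ and $v$, and $\Delta_2(G)=\max_{u\neq v}\operatorname{codeg}(u,v)$. $\chi(G)$ is the chromatic number. -}

module Defs where

open import Data.Nat using (ℕ; zero; suc; _+_; _⊔_)
open import Data.Bool using (Bool; true; false; _∧_; if_then_else_)
open import Data.Fin using (Fin)
open import Data.Fin.Subset using (Subset; _∈_)
open import Data.List using (List; foldr; map; filter; length; allFin; concatMap)
open import Data.Product using (Σ; _×_; ∃; ∃₂)
open import Data.Sum using (_⊎_)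
open import Relation.Binary.PropositionalEquality using (_≡_; _≢_)
open import Relation.Nullary using (¬_)
open import Relation.Nullary.Decidable using (⌊_⌋)
open import Data.Fin using (_≟_)
open import Function.Bundles using (_⇔_)
open import Relation.Nullary.Decidable using (T?)

record SimpleGraph (n : ℕ) : Set where
  field
    adj     : Fin n → Fin n → Bool
    symm    : ∀ u v → adj u v ≡ adj v u
    irrefl  : ∀ v → adj v v ≡ false

open SimpleGraph public

Adj : ∀ {n} → SimpleGraph n → Fin n → Fin n → Set
Adj G u v = adj G u v ≡ true

IsClique : ∀ {n} → SimpleGraph n → Subset n → Set
IsClique G S = ∀ u v → u ∈ S → v ∈ S → u ≢ v → Adj G u v

InClosedNbhd : ∀ {n} → SimpleGraph n → Fin n → Fin n → Set
InClosedNbhd G v w = (w ≡ v) ⊎ Adj G v w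

IsQuasiLine : ∀ {n} → SimpleGraph n → Set
IsQuasiLine {n} G =
  ∀ v → Σ (Subset n) λ A → Σ (Subset n) λ B →
    IsClique G A × IsClique G B ×
    (∀ w → (InClosedNbhd G v w ⇔ ((w ∈ A) ⊎ (w ∈ B))))

codeg : ∀ {n} → SimpleGraph n → Fin n → Fin n → ℕ
codeg {n} G u v = length (filter (λ w → T? (adj G u w ∧ adj G v w)) (allFin n))

-- Δ₂(G): maximum codegree over pairs of distinct vertices (0 if there are none)
Δ₂ : ∀ {n} → SimpleGraph n → ℕ
Δ₂ {n} G = foldr _⊔_ 0
  (concatMap (λ u → map (λ v → if ⌊ u ≟ v ⌋ then 0 else codeg G u v) (allFin n)) (allFin n))

IsProperColouring : ∀ {n} → SimpleGraph n → (k : ℕ) → (Fin n → Fin k) → Set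
IsProperColouring G k c = ∀ u v → Adj G u v → c u ≢ c v

χ≤ : ∀ {n} → SimpleGraph n → ℕ → Set
χ≤ {n} G k = Σ (Fin n → Fin k) λ c → IsProperColouring G k c

{-# OPTIONS --safe #-}

-- Let k = Δ₂ + 3 and take a minimal graph that is not k-colourable.  A colouring of G − h leaves a
-- hole h that sees all k colours; the hole moves to a neighbour t whose colour h sees only at t.
-- Counting colours, |N(u) ∖ N[v]| ≥ 2 for every edge uv.  Moving holes around shows moreover that
-- there is no twin edge, i.e. no edge vt with N(v) ∖ N[t] complete to N(t) ∖ N[v].  These two facts
-- force G to look like the line graph of a simple graph around a maximum clique K: for v ∈ K the
-- vertices of K − v lie on one side of N(v), so N(v) ∖ K is a clique, and a vertex outside K has at
-- most one neighbour in K on each of its two sides.  Then Vizing's fan argument works inside K, with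
-- Kempe chains that are paths because G is claw-free.
module Submission where

open import Defs
open import Data.Nat using (ℕ; _+_)
open import Data.Nat using (zero; suc; _≤_; _<_; _⊔_; z≤n; s≤s)
open import Data.Nat.Properties using (≤-refl; ≤-trans; <⇒≱; ≰⇒>; m≤n⇒m≤1+n; ≤∧≢⇒<; <-cmp; _≤?_; +-suc; +-comm; +-monoʳ-≤; m≤m+n; m≤m⊔n; m≤n⊔m)
import Data.Nat.Properties as ℕ
open import Data.Bool using (Bool; true; T; _∧_; if_then_else_)
import Data.Bool.Properties as Bool
open import Data.Fin using (Fin; zero; suc; punchIn; punchOut; _≟_)
open import Data.Fin.Subset using () renaming (_∈_ to _∈ˢ_)
open import Data.Fin.Subset.Properties using () renaming (_∈?_ to _∈ˢ?_)
open import Data.Fin.Properties using (any?; all?; ¬∀⟶∃¬; punchIn-injective; punchIn-punchOut)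
open import Data.List using (List; []; _∷_; map; filter; foldr; length; allFin)
open import Data.List.Properties using (length-map; length-tabulate; filter-all; filter-notAll)
open import Data.List.Relation.Unary.All as All using (All; []; _∷_)
open import Data.List.Relation.Unary.All.Properties using (all-filter)
import Data.List.Relation.Unary.All.Properties as All
open import Data.List.Relation.Unary.Any as Any using (here; there)
open import Data.List.Relation.Unary.AllPairs using ([]; _∷_)
open import Data.List.Relation.Unary.Unique.Propositional using (Unique)
import Data.List.Relation.Unary.Unique.Propositional.Properties as Unique
open import Data.List.Membership.Propositional using (_∈_; _∉_; lose)
open import Data.List.Membership.Propositional.Properties using (∈-map⁺; ∈-filter⁺; ∈-filter⁻; ∈-allFin; ∈-concatMap⁺)
import Data.List.Membership.DecPropositional as DecMembership
open import Data.Product using (Σ; ∃; ∃₂; _×_; _,_; proj₁; proj₂)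
open import Data.Sum using (_⊎_; inj₁; inj₂)
open import Data.Empty using (⊥; ⊥-elim)
open import Function using (_∘_)
open import Function.Bundles using (Equivalence)
open import Relation.Nullary using (¬_; Dec; yes; no)
open import Relation.Nullary.Decidable using (¬?; _×-dec_; _→-dec_; map′; does; ⌊_⌋; T?)
open import Relation.Binary.Definitions using (tri<; tri≈; tri>)
open import Relation.Binary.Construct.Closure.ReflexiveTransitive as Star using (Star; ε; _◅_; _◅◅_)
open import Relation.Binary.PropositionalEquality using (_≡_; _≢_; refl; sym; trans; cong₂; subst; ≢-sym)

-- A vertex has only two sides, so neighbours separated from the same third one share a side; most
-- adjacencies below arise this way.
both-differ : ∀ {a b x : Bool} → a ≢ x → b ≢ x → a ≡ b
both-differ {a} {b} {x} a≢x b≢x = trans (Bool.¬-not a≢x) (sym (Bool.¬-not b≢x))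

-- Finite sets as repetition-free lists, and the pigeonhole principle.

_∖_ : ∀ {n} → List (Fin n) → Fin n → List (Fin n)
xs ∖ x = filter (λ y → ¬? (y ≟ x)) xs

∈-∖⁺ : ∀ {n} {x y : Fin n} {xs} → y ∈ xs → y ≢ x → y ∈ xs ∖ x
∈-∖⁺ {x = x} = ∈-filter⁺ (λ y → ¬? (y ≟ x))

∈-∖⁻ : ∀ {n} {x y : Fin n} xs → y ∈ xs ∖ x → y ∈ xs × y ≢ x
∈-∖⁻ {x = x} xs = ∈-filter⁻ (λ y → ¬? (y ≟ x)) {xs = xs}

∖-unique : ∀ {n} {x : Fin n} {xs} → Unique xs → Unique (xs ∖ x)
∖-unique {x = x} = Unique.filter⁺ (λ y → ¬? (y ≟ x))

length-∖-< : ∀ {n} {x : Fin n} {xs} → x ∈ xs → length (xs ∖ x) < length xs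
length-∖-< {x = x} {xs} x∈xs =
  filter-notAll (λ y → ¬? (y ≟ x)) xs (Any.map (λ x≡y y≢x → y≢x (sym x≡y)) x∈xs)

length-∖-≥ : ∀ {n} (x : Fin n) {xs} → Unique xs → length xs ≤ suc (length (xs ∖ x))
length-∖-≥ x {[]} _ = z≤n
length-∖-≥ x {y ∷ xs} (y∉xs ∷ u) with y ≟ x
... | no  _    = s≤s (length-∖-≥ x u)
... | yes refl
  rewrite filter-all (λ z → ¬? (z ≟ x)) {xs} (All.map ≢-sym y∉xs) = ≤-refl

unique-⊆-length : ∀ {n} {xs ys : List (Fin n)} → Unique xs → (∀ {x} → x ∈ xs → x ∈ ys) →
                  length xs ≤ length ys
unique-⊆-length {xs = []} _ _ = z≤n
unique-⊆-length {xs = x ∷ xs} {ys} (x∉xs ∷ u) xs⊆ys =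
  ≤-trans (s≤s (unique-⊆-length u λ z∈xs → ∈-∖⁺ (xs⊆ys (there z∈xs)) (≢-sym (All.lookup x∉xs z∈xs))))
          (length-∖-< (xs⊆ys (here refl)))

missing-element : ∀ {k} (ys : List (Fin k)) → length ys < k → ∃ λ γ → γ ∉ ys
missing-element {k} ys ys<k = ¬∀⟶∃¬ k (_∈ ys) (_∈? ys) λ full →
  <⇒≱ ys<k (subst (_≤ length ys) (length-tabulate {n = k} (λ i → i))
             (unique-⊆-length (Unique.allFin⁺ k) (λ {γ} _ → full γ)))
  where open DecMembership _≟_ using (_∈?_)

-- When the goal is `⊥`, this allows membership in a Kempe chain to be taken as decided at all
-- vertices at once.
¬¬-finite : ∀ {n} {P : Fin n → Set} → (∀ i → ¬ ¬ P i) → ¬ ¬ (∀ i → P i)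
¬¬-finite {zero}  _ k = k λ ()
¬¬-finite {suc n} h k = h zero λ p₀ → ¬¬-finite (h ∘ suc) λ ps → k λ { zero → p₀ ; (suc i) → ps i }

¬¬-dec : ∀ {A : Set} → ¬ ¬ Dec A
¬¬-dec k = k (no (k ∘ yes))

-- Trails in a graph of maximum degree two.

module Trail {n : ℕ} (Link : Fin n → Fin n → Set)
  (link-sym : ∀ {x y} → Link x y → Link y x)
  (two-links : ∀ {x y z z′} → Link x y → Link x z → Link x z′ → z ≢ y → z′ ≢ y → z ≡ z′)
  where

  -- Isolated vertices count as ends too.
  End : Fin n → Set
  End x = ∀ {y z} → Link x y → Link x z → y ≡ z

  -- Walk a m x y: a walk from a that never turns back and whose m-th step leads from x to y.
  data Walk (a : Fin n) : ℕ → Fin n → Fin n → Set where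
    start : ∀ {y} → Link a y → Walk a 0 a y
    step  : ∀ {m x y z} → Walk a m x y → Link y z → z ≢ x → Walk a (suc m) y z

  last-link : ∀ {a m x y} → Walk a m x y → Link x y
  last-link (start l)    = l
  last-link (step _ l _) = l

  -- An end leaves no choice for the first step and `two-links` none for the later ones.
  walk-unique : ∀ {a m x y x′ y′} → End a → Walk a m x y → Walk a m x′ y′ → x ≡ x′ × y ≡ y′
  walk-unique end (start l) (start l′) = refl , end l l′
  walk-unique end (step w l z≢x) (step w′ l′ z′≢x′) with walk-unique end w w′
  ... | refl , refl = refl , two-links (link-sym (last-link w)) l l′ z≢x z′≢x′

  Visited : Fin n → Fin n → Set
  Visited a x = x ≡ a ⊎ ∃₂ λ m p → Walk a m p x

  predecessor : ∀ {a m x y} → Walk a m x y → Visited a x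
  predecessor (start _)    = inj₁ refl
  predecessor (step w _ _) = inj₂ (_ , _ , w)

  -- A link either leads back to the predecessor on the walk or prolongs the walk, so the walks from
  -- `a` cover its whole component.
  visited-closed : ∀ {a x y} → Visited a x → Star Link x y → Visited a y
  visited-closed v ε = v
  visited-closed (inj₁ refl) (l ◅ ls) = visited-closed (inj₂ (_ , _ , start l)) ls
  visited-closed (inj₂ (m , p , w)) (_◅_ {j = z} l ls) with z ≟ p
  ... | yes refl = visited-closed (predecessor w) ls
  ... | no z≢p   = visited-closed (inj₂ (_ , _ , step w l z≢p)) ls

  continues : ∀ {a m m′ p q} → m < m′ → Walk a m′ p q →
              ∃₂ λ x y → ∃ λ z → Walk a m x y × Link y z × z ≢ x
  continues {m = m} (s≤s m≤m′) (step {m = m′} w l z≢x) with m ℕ.≟ m′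
  ... | yes refl = _ , _ , _ , w , l , z≢x
  ... | no m≢m′  = continues (≤∧≢⇒< m≤m′ m≢m′) w

  stops-at-end : ∀ {a b m m′ p q c} → End a → End b → Walk a m p b → Walk a m′ q c → ¬ m < m′
  stops-at-end end-a end-b w w′ m<m′ with continues m<m′ w′
  ... | _ , _ , _ , w″ , l , z≢x with walk-unique end-a w w″
  ... | refl , refl = z≢x (end-b l (link-sym (last-link w)))

  -- Both `b` and `c` lie on the one walk that starts at `a`. Whichever comes first stops the walk,
  -- and equal positions mean equal vertices.
  no-three-ends : ∀ {a b c} → End a → End b → End c → a ≢ b → a ≢ c → b ≢ c →
                  Star Link a b → Star Link a c → ⊥
  no-three-ends end-a end-b end-c a≢b a≢c b≢c ab ac
    with visited-closed (inj₁ refl) ab | visited-closed (inj₁ refl) ac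
  ... | inj₁ b≡a | _ = a≢b (sym b≡a)
  ... | inj₂ _ | inj₁ c≡a = a≢c (sym c≡a)
  ... | inj₂ (m , _ , w) | inj₂ (m′ , _ , w′) with <-cmp m m′
  ... | tri< m<m′ _ _ = stops-at-end end-a end-b w w′ m<m′
  ... | tri≈ _ refl _ = b≢c (proj₂ (walk-unique end-a w w′))
  ... | tri> _ _ m′<m = stops-at-end end-a end-c w′ w m′<m

-- Structure of a vertex-critical counterexample.

-- sd v x says which of the two cliques covering N(v) contains x; it is junk for x ∉ N(v).
module Critical {n : ℕ} (d : ℕ) (G : SimpleGraph n)
  (sd : Fin n → Fin n → Bool)
  (same-side : ∀ {v x y} → Adj G v x → Adj G v y → x ≢ y → sd v x ≡ sd v y → Adj G x y)
  (codegree : ∀ {u v} → u ≢ v → ∀ xs → Unique xs → All (λ w → Adj G u w × Adj G v w) xs → length xs ≤ d)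
  (uncolourable : ∀ c → ¬ IsProperColouring G (3 + d) c)
  (colouring-off : ∀ h → Σ (Fin n → Fin (3 + d)) λ c → ∀ {x y} → x ≢ h → y ≢ h → Adj G x y → c x ≢ c y)
  where

  open DecMembership (_≟_ {n}) using (_∈?_)

  k : ℕ
  k = 3 + d

  V Colouring : Set
  V = Fin n
  Colouring = V → Fin k

  infix 4 _~_ _≁_ _~?_

  _~_ _≁_ : V → V → Set
  x ~ y = Adj G x y
  x ≁ y = ¬ x ~ y

  _~?_ : ∀ x y → Dec (x ~ y)
  x ~? y = adj G x y Bool.≟ true

  ~-sym : ∀ {x y} → x ~ y → y ~ x
  ~-sym {x} {y} = trans (symm G y x)

  ≁-sym : ∀ {x y} → x ≁ y → y ≁ x
  ≁-sym x≁y = x≁y ∘ ~-sym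

  ~⇒≢ : ∀ {x y} → x ~ y → x ≢ y
  ~⇒≢ {x} x~x refl with trans (sym (irrefl G x)) x~x
  ... | ()

  separated : ∀ {z x y} → z ~ x → z ~ y → x ≢ y → x ≁ y → sd z x ≢ sd z y
  separated z~x z~y x≢y x≁y = x≁y ∘ same-side z~x z~y x≢y

  -- N(v) ∖ N[t]
  Out : V → V → V → Set
  Out v t x = v ~ x × x ≢ t × t ≁ x

  out-side : ∀ {v t x} → v ~ t → Out v t x → sd v x ≢ sd v t
  out-side v~t (v~x , x≢t , t≁x) = separated v~x v~t x≢t (≁-sym t≁x)

  out-out-≢ : ∀ {v t x y} → Out v t x → Out t v y → x ≢ y
  out-out-≢ (v~x , _) (_ , _ , v≁y) refl = v≁y v~x

  -- Colourings with a hole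

  -- Colourings stay total; the value at the hole is junk.
  ProperOff : V → Colouring → Set
  ProperOff h c = ∀ {x y} → x ≢ h → y ≢ h → x ~ y → c x ≢ c y

  _[_≔_] : Colouring → V → Fin k → Colouring
  (c [ h ≔ γ ]) x with x ≟ h
  ... | yes _ = γ
  ... | no  _ = c x

  ≔-same : ∀ c h γ → (c [ h ≔ γ ]) h ≡ γ
  ≔-same c h γ with h ≟ h
  ... | yes _  = refl
  ... | no h≢h = ⊥-elim (h≢h refl)

  ≔-other : ∀ c {h x} γ → x ≢ h → (c [ h ≔ γ ]) x ≡ c x
  ≔-other c {h} {x} γ x≢h with x ≟ h
  ... | yes x≡h = ⊥-elim (x≢h x≡h)
  ... | no _    = refl

  -- A colour unseen by the hole could fill it.
  sees : ∀ {h c} → ProperOff h c → ∀ γ → ∃ λ x → h ~ x × c x ≡ γ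
  sees {h} {c} pc γ with any? (λ x → (h ~? x) ×-dec (c x ≟ γ))
  ... | yes p = p
  ... | no ¬p = ⊥-elim (uncolourable (c [ h ≔ γ ]) proper)
    where
    proper : IsProperColouring G k (c [ h ≔ γ ])
    proper x y x~y with x ≟ h | y ≟ h
    ... | yes refl | yes refl = λ _ → ~⇒≢ x~y refl
    ... | yes refl | no _     = λ γ≡ → ¬p (y , x~y , sym γ≡)
    ... | no _     | yes refl = λ ≡γ → ¬p (x , ~-sym x~y , ≡γ)
    ... | no x≢h   | no y≢h   = pc x≢h y≢h x~y

  shift : ∀ {h c t} → ProperOff h c → (∀ {x} → h ~ x → c x ≡ c t → x ≡ t) →
          ProperOff t (c [ h ≔ c t ])
  shift {h} {c} {t} pc unique {x} {y} x≢t y≢t x~y with x ≟ h | y ≟ h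
  ... | yes refl | yes refl = λ _ → ~⇒≢ x~y refl
  ... | yes refl | no _     = λ ct≡ → y≢t (unique x~y (sym ct≡))
  ... | no _     | yes refl = λ ≡ct → x≢t (unique (~-sym x~y) ≡ct)
  ... | no x≢h   | no y≢h   = pc x≢h y≢h x~y

  common : V → V → List V
  common u v = filter (λ w → (u ~? w) ×-dec (v ~? w)) (allFin n)

  common-length : ∀ {u v} → u ≢ v → length (common u v) ≤ d
  common-length {u} {v} u≢v = codegree u≢v (common u v)
    (Unique.filter⁺ (λ w → (u ~? w) ×-dec (v ~? w)) (Unique.allFin⁺ n))
    (all-filter (λ w → (u ~? w) ×-dec (v ~? w)) (allFin n))

  ∈-common : ∀ {u v w} → u ~ w → v ~ w → w ∈ common u v
  ∈-common {u} {v} {w} u~w v~w = ∈-filter⁺ (λ w → (u ~? w) ×-dec (v ~? w)) (∈-allFin w) (u~w , v~w)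

  common-colours-length : ∀ (c : Colouring) {u v} → u ≢ v → length (map c (common u v)) ≤ d
  common-colours-length c {u} {v} u≢v =
    subst (_≤ d) (sym (length-map c (common u v))) (common-length u≢v)

  abstract
    -- The colours of `v` and of N(u) ∩ N(v) number at most d + 1, so two of the d + 3 are left.
    -- With the hole at `u`, both are seen, and only outside N[v].
    out-two : ∀ {u v} → u ~ v → ∃₂ λ x y → Out u v x × Out u v y × x ≢ y
    out-two {u} {v} u~v with colouring-off u
    ... | c , pc with missing-element (c v ∷ map c (common u v))
                        (s≤s (m≤n⇒m≤1+n (s≤s (common-colours-length c (~⇒≢ u~v)))))
    ... | γ₁ , γ₁∉ with missing-element (γ₁ ∷ c v ∷ map c (common u v))
                          (s≤s (s≤s (s≤s (common-colours-length c (~⇒≢ u~v)))))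
    ... | γ₂ , γ₂∉ with sees pc γ₁ | sees pc γ₂
    ... | x , u~x , refl | y , u~y , refl =
      x , y , out u~x γ₁∉ , out u~y (γ₂∉ ∘ there) , λ { refl → γ₂∉ (here refl) }
      where
      out : ∀ {z} → u ~ z → c z ∉ c v ∷ map c (common u v) → Out u v z
      out u~z cz∉ = u~z , (λ { refl → cz∉ (here refl) }) ,
                    λ v~z → cz∉ (there (∈-map⁺ c (∈-common u~z v~z)))

  -- Twin edges

  Twin : V → V → Set
  Twin v t = ∀ {x y} → Out v t x → Out t v y → x ~ y

  Twin-sym : ∀ {v t} → Twin v t → Twin t v
  Twin-sym tw ox oy = ~-sym (tw oy ox)

  out-clique : ∀ {v t x y} → v ~ t → Out v t x → Out v t y → x ≢ y → x ~ y
  out-clique v~t ox oy x≢y =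
    same-side (proj₁ ox) (proj₁ oy) x≢y (both-differ (out-side v~t ox) (out-side v~t oy))

  -- If `v` sees `y` but `t` does not, then `y` and `s₂` share a clique of N(v). If `v` misses `y`,
  -- so does `t`; take τ in `Out t v`. At `s₁` both `y` and τ lie opposite `v`, then at τ both `y`
  -- and `s₂` lie opposite `t`, which gives `y ~ s₂`.
  twin-out-common : ∀ {v t s₁ s₂ y} → v ~ t → Twin v t → Out v t s₁ → Out v t s₂ → s₁ ~ s₂ →
                    Out s₁ s₂ y → v ~ y × t ~ y
  twin-out-common {v} {t} {s₁} {s₂} {y} v~t tw o₁ o₂ s₁~s₂ (s₁~y , y≢s₂ , s₂≁y) with v ~? y
  ... | yes v~y with t ~? y
  ...   | yes t~y = v~y , t~y
  ...   | no  t≁y = ⊥-elim (s₂≁y (out-clique v~t o₂ (v~y , y≢t , t≁y) (≢-sym y≢s₂)))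
    where
    y≢t : y ≢ t
    y≢t refl = proj₂ (proj₂ o₁) (~-sym s₁~y)
  twin-out-common {v} {t} {s₁} {s₂} {y} v~t tw o₁ o₂ s₁~s₂ (s₁~y , y≢s₂ , s₂≁y) | no v≁y
    with out-two (~-sym v~t)
  ... | τ , _ , oτ , _ = ⊥-elim (s₂≁y (~-sym y~s₂))
    where
    t~τ = proj₁ oτ
    s₁~τ = tw o₁ oτ
    s₂~τ = tw o₂ oτ
    y≢v : y ≢ v
    y≢v refl = s₂≁y (~-sym (proj₁ o₂))
    y≢t : y ≢ t
    y≢t refl = proj₂ (proj₂ o₁) (~-sym s₁~y)
    y≢τ : y ≢ τ
    y≢τ refl = s₂≁y s₂~τ
    t≁y : t ≁ y
    t≁y t~y = s₂≁y (tw o₂ (t~y , y≢v , v≁y))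
    s₁~v = ~-sym (proj₁ o₁)
    y~τ : y ~ τ
    y~τ = same-side s₁~y s₁~τ y≢τ
      (both-differ (separated s₁~y s₁~v y≢v (≁-sym v≁y))
                   (separated s₁~τ s₁~v (proj₁ (proj₂ oτ)) (≁-sym (proj₂ (proj₂ oτ)))))
    y~s₂ : y ~ s₂
    y~s₂ = same-side (~-sym y~τ) (~-sym s₂~τ) y≢s₂
      (both-differ (separated (~-sym y~τ) (~-sym t~τ) y≢t (≁-sym t≁y))
                   (separated (~-sym s₂~τ) (~-sym t~τ) (proj₁ (proj₂ o₂)) (≁-sym (proj₂ (proj₂ o₂)))))

  -- With v and t uncoloured and three colours free on N(v) ∩ N(t): colour v by μ₁, t by μ₃ and move
  -- the hole to s₁, then to s₂.  As s₁ and s₂ differ only inside N(v) ∩ N(t), where they are again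
  -- twins, a colour absent from their common neighbourhood would be repeated on adjacent vertices.
  twin-hole : ∀ {v t c μ₁ μ₂ μ₃ s₁ s₂} → v ~ t → Twin v t →
    (∀ {x y} → x ≢ v → x ≢ t → y ≢ v → y ≢ t → x ~ y → c x ≢ c y) →
    (∀ {w} → v ~ w → t ~ w → c w ≢ μ₁ × c w ≢ μ₂ × c w ≢ μ₃) →
    μ₁ ≢ μ₂ → μ₁ ≢ μ₃ → Out v t s₁ → c s₁ ≡ μ₁ → Out v t s₂ → c s₂ ≡ μ₂ →
    (∀ {y} → Out t v y → c y ≢ μ₃) → ⊥
  twin-hole {v} {t} {c} {μ₁} {μ₂} {μ₃} {s₁} {s₂} v~t tw pc free μ₁≢μ₂ μ₁≢μ₃ o₁ cs₁ o₂ cs₂ T∌μ₃ =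
    clash (sees pc₁ γ) (sees pc₂ γ)
    where
    off-v : ∀ {x} → Out v t x → x ≢ v
    off-v (v~x , _) = ≢-sym (~⇒≢ v~x)

    s₁≢s₂ : s₁ ≢ s₂
    s₁≢s₂ refl = μ₁≢μ₂ (trans (sym cs₁) cs₂)

    s₁~s₂ : s₁ ~ s₂
    s₁~s₂ = out-clique v~t o₁ o₂ s₁≢s₂

    c₁ : Colouring
    c₁ = (c [ t ≔ μ₃ ]) [ v ≔ μ₁ ]

    v-ok : ∀ {y} → y ≢ t → y ≢ v → y ≢ s₁ → v ~ y → c y ≢ μ₁
    v-ok {y} y≢t y≢v y≢s₁ v~y cy with t ~? y
    ... | yes t~y = proj₁ (free v~y t~y) cy
    ... | no  t≁y = pc y≢v y≢t (off-v o₁) (proj₁ (proj₂ o₁))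
                      (out-clique v~t (v~y , y≢t , t≁y) o₁ y≢s₁) (trans cy (sym cs₁))

    t-ok : ∀ {y} → y ≢ v → t ~ y → c y ≢ μ₃
    t-ok {y} y≢v t~y with v ~? y
    ... | yes v~y = proj₂ (proj₂ (free v~y t~y))
    ... | no  v≁y = T∌μ₃ (t~y , y≢v , v≁y)

    pc₁ : ProperOff s₁ c₁
    pc₁ {x} {y} x≢s₁ y≢s₁ x~y with x ≟ v | y ≟ v
    ... | yes refl | yes refl = λ _ → ~⇒≢ x~y refl
    pc₁ {x} {y} x≢s₁ y≢s₁ x~y | yes refl | no y≢v with y ≟ t
    ... | yes refl = μ₁≢μ₃
    ... | no y≢t   = ≢-sym (v-ok y≢t y≢v y≢s₁ x~y)
    pc₁ {x} {y} x≢s₁ y≢s₁ x~y | no x≢v | yes refl with x ≟ t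
    ... | yes refl = ≢-sym μ₁≢μ₃
    ... | no x≢t   = v-ok x≢t x≢v x≢s₁ (~-sym x~y)
    pc₁ {x} {y} x≢s₁ y≢s₁ x~y | no x≢v | no y≢v with x ≟ t | y ≟ t
    ... | yes refl | yes refl = λ _ → ~⇒≢ x~y refl
    ... | yes refl | no _     = ≢-sym (t-ok y≢v x~y)
    ... | no _     | yes refl = t-ok x≢v (~-sym x~y)
    ... | no x≢t   | no y≢t   = pc x≢v x≢t y≢v y≢t x~y

    c₁-else : ∀ {x} → x ≢ v → x ≢ t → c₁ x ≡ c x
    c₁-else x≢v x≢t = trans (≔-other _ μ₁ x≢v) (≔-other c μ₃ x≢t)

    c₁s₂ : c₁ s₂ ≡ μ₂
    c₁s₂ = trans (c₁-else (off-v o₂) (proj₁ (proj₂ o₂))) cs₂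

    unique : ∀ {y} → s₁ ~ y → c₁ y ≡ c₁ s₂ → y ≡ s₂
    unique {y} s₁~y eq with y ≟ s₂ | s₂ ~? y
    ... | yes y≡s₂ | _        = y≡s₂
    ... | no _     | yes s₂~y = ⊥-elim (pc₁ (≢-sym (~⇒≢ s₁~y)) (≢-sym s₁≢s₂) (~-sym s₂~y) eq)
    -- Such a `y` would be in N(v) ∩ N(t), where μ₂ does not occur.
    ... | no y≢s₂  | no s₂≁y with twin-out-common v~t tw o₁ o₂ s₁~s₂ (s₁~y , y≢s₂ , s₂≁y)
    ...   | v~y , t~y = ⊥-elim (proj₁ (proj₂ (free v~y t~y))
            (trans (sym (c₁-else (≢-sym (~⇒≢ v~y)) (≢-sym (~⇒≢ t~y)))) (trans eq c₁s₂)))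

    pc₂ : ProperOff s₂ (c₁ [ s₁ ≔ c₁ s₂ ])
    pc₂ = shift pc₁ unique

    γ-missing = missing-element (c₁ s₂ ∷ map c₁ (common s₁ s₂))
                  (s≤s (m≤n⇒m≤1+n (s≤s (common-colours-length c₁ s₁≢s₂))))

    γ : Fin k
    γ = proj₁ γ-missing

    γ≢ : γ ≢ c₁ s₂
    γ≢ eq = proj₂ γ-missing (here eq)

    γ∉ : ∀ {w} → s₁ ~ w → s₂ ~ w → c₁ w ≢ γ
    γ∉ s₁~w s₂~w eq = proj₂ γ-missing
      (there (subst (_∈ map c₁ (common s₁ s₂)) eq (∈-map⁺ c₁ (∈-common s₁~w s₂~w))))

    clash : (∃ λ y → s₁ ~ y × c₁ y ≡ γ) → (∃ λ z → s₂ ~ z × (c₁ [ s₁ ≔ c₁ s₂ ]) z ≡ γ) → ⊥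
    clash (y , s₁~y , cy) (z , s₂~z , cz) =
      pc₁ (≢-sym (~⇒≢ s₁~y)) z≢s₁ y~z (trans cy (sym c₁z))
      where
      z≢s₁ : z ≢ s₁
      z≢s₁ refl = γ≢ (trans (sym cz) (≔-same c₁ s₁ (c₁ s₂)))
      c₁z : c₁ z ≡ γ
      c₁z = trans (sym (≔-other c₁ (c₁ s₂) z≢s₁)) cz
      oy : Out s₁ s₂ y
      oy = s₁~y , (λ { refl → γ≢ (sym cy) }) , λ s₂~y → γ∉ s₁~y s₂~y cy
      oz : Out s₂ s₁ z
      oz = s₂~z , z≢s₁ , λ s₁~z → γ∉ s₁~z s₂~z c₁z
      vy = twin-out-common v~t tw o₁ o₂ s₁~s₂ oy
      vz = twin-out-common v~t tw o₂ o₁ (~-sym s₁~s₂) oz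
      -- At `v`, `y` lies opposite `s₂` and `z` opposite `s₁`, while `s₁` and `s₂` share a side.
      y~z : y ~ z
      y~z = same-side (proj₁ vy) (proj₁ vz) (out-out-≢ oy oz) (both-differ
        (separated (proj₁ vy) (proj₁ o₂) (proj₁ (proj₂ oy)) (≁-sym (proj₂ (proj₂ oy))))
        (subst (λ b → sd v z ≢ b) (both-differ (out-side v~t o₁) (out-side v~t o₂))
          (separated (proj₁ vz) (proj₁ o₁) z≢s₁ (≁-sym (proj₂ (proj₂ oz))))))

  -- Three colours are free on N(v) ∩ N(t), and by twinness none occurs on both `Out v t` and
  -- `Out t v`. Since `v` and `t` cannot both be coloured, all three occur on the same one of these
  -- sets and none on the other, which is the situation of `twin-hole`.
  no-twins : ∀ {v t} → v ~ t → ¬ Twin v t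
  no-twins {v} {t} v~t tw with colouring-off v
  ... | c , pc with missing-element (map c (common v t))
                      (s≤s (m≤n⇒m≤1+n (m≤n⇒m≤1+n (common-colours-length c (~⇒≢ v~t)))))
  ... | μ₁ , μ₁∉ with missing-element (μ₁ ∷ map c (common v t))
                        (s≤s (m≤n⇒m≤1+n (s≤s (common-colours-length c (~⇒≢ v~t)))))
  ... | μ₂ , μ₂∉ with missing-element (μ₂ ∷ μ₁ ∷ map c (common v t))
                        (s≤s (s≤s (s≤s (common-colours-length c (~⇒≢ v~t)))))
  ... | μ₃ , μ₃∉ = split (onS? μ₁)
    where
    OnS OnT : Fin k → Set
    OnS μ = ∃ λ x → Out v t x × c x ≡ μ
    OnT μ = ∃ λ x → Out t v x × c x ≡ μ

    on? : ∀ a b μ → Dec (∃ λ x → Out a b x × c x ≡ μ)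
    on? a b μ = any? λ x → ((a ~? x) ×-dec (¬? (x ≟ b) ×-dec ¬? (b ~? x))) ×-dec (c x ≟ μ)

    onS? : ∀ μ → Dec (OnS μ)
    onS? = on? v t

    onT? : ∀ μ → Dec (OnT μ)
    onT? = on? t v

    avoid : ∀ {μ w} → μ ∉ map c (common v t) → v ~ w → t ~ w → c w ≢ μ
    avoid μ∉ v~w t~w refl = μ∉ (∈-map⁺ c (∈-common v~w t~w))

    not-both : ∀ {μ} → OnS μ → OnT μ → ⊥
    not-both (x , ox , refl) (y , oy , cy) =
      pc (≢-sym (~⇒≢ (proj₁ ox))) (proj₁ (proj₂ oy)) (tw ox oy) (sym cy)

    -- otherwise v and t could be coloured by μ and ν
    one-on : ∀ {μ ν} → μ ≢ ν → μ ∉ map c (common v t) → ν ∉ map c (common v t) →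
             ¬ OnS μ → ¬ OnT ν → ⊥
    one-on {μ} {ν} μ≢ν μ∉ ν∉ ¬S ¬T = uncolourable ((c [ t ≔ ν ]) [ v ≔ μ ]) proper
      where
      v-ok : ∀ {y} → y ≢ t → v ~ y → c y ≢ μ
      v-ok {y} y≢t v~y cy with t ~? y
      ... | yes t~y = avoid μ∉ v~y t~y cy
      ... | no  t≁y = ¬S (y , (v~y , y≢t , t≁y) , cy)
      t-ok : ∀ {y} → y ≢ v → t ~ y → c y ≢ ν
      t-ok {y} y≢v t~y cy with v ~? y
      ... | yes v~y = avoid ν∉ v~y t~y cy
      ... | no  v≁y = ¬T (y , (t~y , y≢v , v≁y) , cy)
      proper : IsProperColouring G k ((c [ t ≔ ν ]) [ v ≔ μ ])
      proper x y x~y with x ≟ v | y ≟ v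
      ... | yes refl | yes refl = λ _ → ~⇒≢ x~y refl
      proper x y x~y | yes refl | no y≢v with y ≟ t
      ... | yes refl = μ≢ν
      ... | no y≢t   = ≢-sym (v-ok y≢t x~y)
      proper x y x~y | no x≢v | yes refl with x ≟ t
      ... | yes refl = ≢-sym μ≢ν
      ... | no x≢t   = v-ok x≢t (~-sym x~y)
      proper x y x~y | no x≢v | no y≢v with x ≟ t | y ≟ t
      ... | yes refl | yes refl = λ _ → ~⇒≢ x~y refl
      ... | yes refl | no _     = ≢-sym (t-ok y≢v x~y)
      ... | no _     | yes refl = t-ok x≢v (~-sym x~y)
      ... | no x≢t   | no y≢t   = pc x≢v y≢v x~y

    μ₁≢μ₂ : μ₁ ≢ μ₂
    μ₁≢μ₂ eq = μ₂∉ (here (sym eq))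
    μ₁≢μ₃ : μ₁ ≢ μ₃
    μ₁≢μ₃ eq = μ₃∉ (there (here (sym eq)))

    free : ∀ {w} → v ~ w → t ~ w → c w ≢ μ₁ × c w ≢ μ₂ × c w ≢ μ₃
    free v~w t~w = avoid μ₁∉ v~w t~w , avoid (μ₂∉ ∘ there) v~w t~w , avoid (μ₃∉ ∘ there ∘ there) v~w t~w

    split : Dec (OnS μ₁) → ⊥
    split (yes S₁@(s₁ , o₁ , cs₁)) with onS? μ₂ | onS? μ₃
    ... | no ¬S₂ | _      = one-on (≢-sym μ₁≢μ₂) (μ₂∉ ∘ there) μ₁∉ ¬S₂ (not-both S₁)
    ... | yes _  | no ¬S₃ = one-on (≢-sym μ₁≢μ₃) (μ₃∉ ∘ there ∘ there) μ₁∉ ¬S₃ (not-both S₁)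
    ... | yes (s₂ , o₂ , cs₂) | yes S₃ =
      twin-hole v~t tw (λ x≢v _ y≢v _ → pc x≢v y≢v) free μ₁≢μ₂ μ₁≢μ₃ o₁ cs₁ o₂ cs₂
        λ oy cy → not-both S₃ (_ , oy , cy)
    split (no ¬S₁) with onT? μ₂ | onT? μ₃
    ... | no ¬T₂ | _      = one-on μ₁≢μ₂ μ₁∉ (μ₂∉ ∘ there) ¬S₁ ¬T₂
    ... | yes _  | no ¬T₃ = one-on μ₁≢μ₃ μ₁∉ (μ₃∉ ∘ there ∘ there) ¬S₁ ¬T₃
    ... | yes T₂@(t₂ , o₂ , ct₂) | yes T₃@(t₃ , o₃ , ct₃) with onT? μ₁
    ...   | no ¬T₁ = one-on (≢-sym μ₁≢μ₂) (μ₂∉ ∘ there) μ₁∉ (λ S₂ → not-both S₂ T₂) ¬T₁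
    ...   | yes (t₁ , o₁ , ct₁) =
      twin-hole (~-sym v~t) (Twin-sym tw) (λ _ x≢v _ y≢v → pc x≢v y≢v)
        (λ t~w v~w → free v~w t~w) μ₁≢μ₂ μ₁≢μ₃ o₁ ct₁ o₂ ct₂
        λ oy cy → not-both (_ , oy , cy) T₃

  -- Separation in triangles and maximum cliques

  -- Otherwise `v` and `x` are twins: every vertex of `Out v x` or `Out x v` is adjacent to `u`, and
  -- at `u` all of them lie opposite the common side of `v` and `x`.
  third-separates : ∀ {v x u} → v ~ x → v ~ u → x ~ u →
                    sd v x ≢ sd v u → sd x v ≢ sd x u → sd u v ≢ sd u x
  third-separates {v} {x} {u} v~x v~u x~u v-sep x-sep u-same = no-twins v~x twin
    where
    out-u : ∀ {p q r} → p ~ q → p ~ u → q ~ u → sd p q ≢ sd p u → Out p q r → r ~ u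
    out-u p~q p~u q~u p-sep o@(p~r , _ , q≁r) =
      same-side p~r p~u (λ { refl → q≁r q~u }) (both-differ (out-side p~q o) (≢-sym p-sep))
    twin : Twin v x
    twin {a} {b} oa ob = same-side (~-sym a~u) (~-sym b~u) (out-out-≢ oa ob) (both-differ
      (separated (~-sym a~u) (~-sym x~u) (proj₁ (proj₂ oa)) (≁-sym (proj₂ (proj₂ oa))))
      (subst (λ s → sd u b ≢ s) u-same
        (separated (~-sym b~u) (~-sym v~u) (proj₁ (proj₂ ob)) (≁-sym (proj₂ (proj₂ ob))))))
      where
      a~u = out-u v~x v~u x~u v-sep oa
      b~u = out-u (~-sym v~x) x~u v~u x-sep ob

  Clique : List V → Set
  Clique L = ∀ {x y} → x ∈ L → y ∈ L → x ≢ y → x ~ y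

  clique-∷ : ∀ {x L} → Clique L → (∀ {y} → y ∈ L → x ~ y) → Clique (x ∷ L)
  clique-∷ cl x~ (here refl) (here refl) x≢x = ⊥-elim (x≢x refl)
  clique-∷ cl x~ (here refl) (there z∈)  _   = x~ z∈
  clique-∷ cl x~ (there y∈)  (here refl) _   = ~-sym (x~ y∈)
  clique-∷ cl x~ (there y∈)  (there z∈)  y≢z = cl y∈ z∈ y≢z

  unique-∷ : ∀ {x L} → Unique L → (∀ {y} → y ∈ L → x ~ y) → Unique (x ∷ L)
  unique-∷ u x~ = All.tabulate (~⇒≢ ∘ x~) ∷ u

  clique-∖ : ∀ {x L} → Clique L → Clique (L ∖ x)
  clique-∖ {L = L} cl y∈ z∈ = cl (proj₁ (∈-∖⁻ L y∈)) (proj₁ (∈-∖⁻ L z∈))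

  -- All further vertices of a clique are common neighbours of its first two.
  clique-length : ∀ {L} → Unique L → Clique L → length L ≤ 2 + d
  clique-length {[]}        _ _ = z≤n
  clique-length {_ ∷ []}    _ _ = s≤s z≤n
  clique-length {x ∷ y ∷ L} ((x≢y ∷ x∉) ∷ (y∉ ∷ u)) cl = s≤s (s≤s (codegree x≢y L u (All.tabulate λ z∈ →
    cl (here refl) (there (there z∈)) (All.lookup x∉ z∈) ,
    cl (there (here refl)) (there (there z∈)) (All.lookup y∉ z∈))))

  -- Sides at the vertices of a maximum clique.

  module MaximumClique (K : List V) (K-unique : Unique K) (K-clique : Clique K)
    (K-max : ∀ L → Unique L → Clique L → length L ≤ length K) where

    no-extension : ∀ {z} → ¬ (∀ {y} → y ∈ K → z ~ y)
    no-extension {z} z~ = <⇒≱ ≤-refl (K-max (z ∷ K) (unique-∷ K-unique z~) (clique-∷ K-clique z~))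

    no-exchange : ∀ {u z₁ z₂} → z₁ ~ z₂ → ¬ (∀ {y} → y ∈ K → y ≢ u → z₁ ~ y × z₂ ~ y)
    no-exchange {u} {z₁} {z₂} z₁~z₂ z~ = <⇒≱ (s≤s (length-∖-≥ u K-unique))
      (K-max (z₁ ∷ z₂ ∷ K ∖ u) (unique-∷ (unique-∷ (∖-unique K-unique) z₂~) z₁~)
        (clique-∷ (clique-∷ (clique-∖ K-clique) z₂~) z₁~))
      where
      z₂~ : ∀ {y} → y ∈ K ∖ u → z₂ ~ y
      z₂~ y∈ = proj₂ (z~ (proj₁ (∈-∖⁻ K y∈)) (proj₂ (∈-∖⁻ K y∈)))
      z₁~ : ∀ {y} → y ∈ z₂ ∷ K ∖ u → z₁ ~ y
      z₁~ (here refl) = z₁~z₂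
      z₁~ (there y∈)  = proj₁ (z~ (proj₁ (∈-∖⁻ K y∈)) (proj₂ (∈-∖⁻ K y∈)))

    -- Two vertices of `Out v u` turn out to be complete to K - u, so exchanging them for `u` would
    -- enlarge `K`.
    one-separates : ∀ {v x u} → v ∈ K → x ∈ K → u ∈ K → v ≢ x → v ≢ u → x ≢ u →
                    sd v x ≢ sd v u → sd x v ≢ sd x u → ⊥
    one-separates {v} {x} {u} v∈ x∈ u∈ v≢x v≢u x≢u v-sep x-sep with out-two v~u
      where v~u = K-clique v∈ u∈ v≢u
    ... | z₁ , z₂ , o₁ , o₂ , z₁≢z₂ =
      no-exchange (out-clique v~u o₁ o₂ z₁≢z₂) λ y∈ y≢u → z~ o₁ y∈ y≢u , z~ o₂ y∈ y≢u
      where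
      v~x = K-clique v∈ x∈ v≢x
      v~u = K-clique v∈ u∈ v≢u
      x~u = K-clique x∈ u∈ x≢u
      u-sep : sd u v ≢ sd u x
      u-sep = third-separates v~x v~u x~u v-sep x-sep

      side-x : ∀ {z} → Out v u z → sd v z ≡ sd v x
      side-x o = both-differ (out-side v~u o) v-sep

      x~z : ∀ {z} → Out v u z → x ~ z
      x~z o@(v~z , _ , u≁z) = same-side v~x v~z (λ { refl → u≁z (~-sym x~u) }) (sym (side-x o))

      -- If y misses z then y plays the role of u, and u, y are twins.
      z~ : ∀ {z} → Out v u z → ∀ {y} → y ∈ K → y ≢ u → z ~ y
      z~ {z} o@(v~z , z≢u , u≁z) {y} y∈ y≢u with z ~? y
      ... | yes z~y = z~y
      ... | no  z≁y = ⊥-elim (no-twins (K-clique u∈ y∈ (≢-sym y≢u)) twin)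
        where
        y≢v : y ≢ v
        y≢v refl = z≁y (~-sym v~z)
        y≢x : y ≢ x
        y≢x refl = z≁y (~-sym (x~z o))
        z≢y : z ≢ y
        z≢y refl = u≁z (K-clique u∈ y∈ (≢-sym y≢u))
        v~y = K-clique v∈ y∈ (≢-sym y≢v)
        x~y = K-clique x∈ y∈ (≢-sym y≢x)
        v-sep-y : sd v x ≢ sd v y
        v-sep-y = subst (_≢ sd v y) (side-x o) (separated v~z v~y z≢y z≁y)
        x-sep-y : sd x v ≢ sd x y
        x-sep-y = subst (_≢ sd x y)
          (both-differ (separated (x~z o) x~u z≢u (≁-sym u≁z)) x-sep)
          (separated (x~z o) x~y z≢y z≁y)
        y-sep : sd y v ≢ sd y x
        y-sep = third-separates v~x v~y x~y v-sep-y x-sep-y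

        -- At `p`, `b` is on the side of `v` or of `x`. In the second case `b ~ x`, and at `x` both
        -- `b` and `v` lie opposite `q`.
        to-v : ∀ {p q b} → v ~ p → v ~ q → x ~ p → x ~ q → sd p v ≢ sd p x → sd x v ≢ sd x q →
               Out p q b → v ~ b
        to-v {p} {q} {b} v~p v~q x~p x~q p-sep x-sep-q (p~b , b≢q , q≁b) with sd p b Bool.≟ sd p v
        ... | yes eq = ~-sym (same-side p~b (~-sym v~p) b≢v eq)
          where
          b≢v : b ≢ v
          b≢v refl = q≁b (~-sym v~q)
        ... | no neq = ~-sym (same-side x~b (~-sym v~x) b≢v (both-differ (separated x~b x~q b≢q (≁-sym q≁b)) x-sep-q))
          where
          b≢v : b ≢ v
          b≢v refl = q≁b (~-sym v~q)
          b≢x : b ≢ x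
          b≢x refl = q≁b (~-sym x~q)
          x~b : x ~ b
          x~b = ~-sym (same-side p~b (~-sym x~p) b≢x (both-differ neq (≢-sym p-sep)))

        twin : Twin u y
        twin {a} {b} oa ob = same-side v~a v~b (out-out-≢ oa ob) (both-differ
          (separated v~a v~y (proj₁ (proj₂ oa)) (≁-sym (proj₂ (proj₂ oa))))
          (subst (λ s → sd v b ≢ s) (both-differ (≢-sym v-sep) (≢-sym v-sep-y))
            (separated v~b v~u (proj₁ (proj₂ ob)) (≁-sym (proj₂ (proj₂ ob))))))
          where
          v~a = to-v v~u v~y x~u x~y u-sep x-sep-y oa
          v~b = to-v v~y v~u x~y x~u y-sep x-sep ob

    Unseparating : V → Set
    Unseparating x = ∀ {y z} → y ∈ K → z ∈ K → y ≢ x → z ≢ x → sd x y ≡ sd x z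

    -- A vertex `p` of `Out v u` makes `x` and `x′` twins. It is adjacent to both, and each
    -- separates it from the rest of `K` because `p` misses `u`; so `p` sees all of `Out x x′` and
    -- `Out x′ x`. By `third-separates`, `x` and `x′` share a side at `p`, and both sets lie
    -- opposite it.
    unseparating-pair : ∀ {v x x′ u} → v ∈ K → x ∈ K → x′ ∈ K → u ∈ K →
      x ≢ v → x′ ≢ v → u ≢ v → x ≢ x′ → sd v x ≡ sd v x′ → sd v x ≢ sd v u →
      Unseparating x → Unseparating x′ → ⊥
    unseparating-pair {v} {x} {x′} {u} v∈ x∈ x′∈ u∈ x≢v x′≢v u≢v x≢x′ same v-sep ux ux′
      with out-two (K-clique v∈ u∈ (≢-sym u≢v))
    ... | p , _ , op@(v~p , p≢u , u≁p) , _ = no-twins x~x′ twin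
      where
      v~u = K-clique v∈ u∈ (≢-sym u≢v)
      v~x = K-clique v∈ x∈ (≢-sym x≢v)
      v~x′ = K-clique v∈ x′∈ (≢-sym x′≢v)
      x~x′ = K-clique x∈ x′∈ x≢x′
      x≢u : x ≢ u
      x≢u refl = v-sep refl
      x′≢u : x′ ≢ u
      x′≢u refl = v-sep same
      x~u = K-clique x∈ u∈ x≢u
      x′~u = K-clique x′∈ u∈ x′≢u
      side-p : sd v p ≡ sd v x
      side-p = both-differ (out-side v~u op) v-sep
      x~p : x ~ p
      x~p = same-side v~x v~p (λ { refl → u≁p (~-sym x~u) }) (sym side-p)
      x′~p : x′ ~ p
      x′~p = same-side v~x′ v~p (λ { refl → u≁p (~-sym x′~u) }) (trans (sym same) (sym side-p))
      p-side : ∀ {y} → y ∈ K → y ~ p → Unseparating y → y ≢ u → ∀ {z} → z ∈ K → z ≢ y → sd y p ≢ sd y z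
      p-side {y} y∈ y~p uy y≢u z∈ z≢y = subst (λ s → sd y p ≢ s) (uy u∈ z∈ (≢-sym y≢u) z≢y)
        (separated y~p (K-clique y∈ u∈ y≢u) p≢u (≁-sym u≁p))

      same-at-p : ∀ {y} → y ∈ K → y ≢ v → y ~ p → Unseparating y → y ≢ u → sd v y ≡ sd v p → sd p y ≡ sd p v
      same-at-p {y} y∈ y≢v y~p uy y≢u eq with sd p y Bool.≟ sd p v
      ... | yes e = e
      ... | no ne = ⊥-elim (third-separates (~-sym y~p) (~-sym v~p) (K-clique y∈ v∈ y≢v) ne
                              (p-side y∈ y~p uy y≢u v∈ (≢-sym y≢v)) (sym eq))

      p-same : sd p x ≡ sd p x′
      p-same = trans (same-at-p x∈ x≢v x~p ux x≢u (sym side-p))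
                     (sym (same-at-p x′∈ x′≢v x′~p ux′ x′≢u (trans (sym same) (sym side-p))))

      out-p : ∀ {y y′ f} → y ∈ K → y′ ∈ K → y ~ y′ → y ~ p → y′ ~ p → Unseparating y → y ≢ u →
              Out y y′ f → f ~ p
      out-p y∈ y′∈ y~y′ y~p y′~p uy y≢u o@(y~f , _ , y′≁f) =
        same-side y~f y~p (λ { refl → y′≁f y′~p })
          (both-differ (out-side y~y′ o) (p-side y∈ y~p uy y≢u y′∈ (≢-sym (~⇒≢ y~y′))))

      twin : Twin x x′
      twin {f} {g} of og = same-side (~-sym f~p) (~-sym g~p) (out-out-≢ of og) (both-differ
        (separated (~-sym f~p) (~-sym x′~p) (proj₁ (proj₂ of)) (≁-sym (proj₂ (proj₂ of))))
        (subst (λ s → sd p g ≢ s) p-same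
          (separated (~-sym g~p) (~-sym x~p) (proj₁ (proj₂ og)) (≁-sym (proj₂ (proj₂ og))))))
        where
        f~p = out-p x∈ x′∈ x~x′ x~p x′~p ux x≢u of
        g~p = out-p x′∈ x∈ (~-sym x~x′) x′~p x~p ux′ x′≢u og

    -- Induction on a list L containing the part of K on the side of x at v.  Moving from v to a vertex
    -- x′ on that side shrinks the side; when it cannot shrink further, x is alone and may be exchanged
    -- for two vertices of N(v) ∖ N[x].
    not-split : ∀ m {v x u} (L : List V) → length L < m → v ∈ K → x ∈ K → u ∈ K → x ≢ v → u ≢ v →
      sd v x ≢ sd v u → (∀ {y} → y ∈ K → y ≢ v → sd v y ≡ sd v x → y ∈ L) → ⊥
    not-split (suc m) {v} {x} {u} L (s≤s L≤m) v∈ x∈ u∈ x≢v u≢v v-sep side⊆L with out-two v~x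
      where v~x = K-clique v∈ x∈ (≢-sym x≢v)
    ... | r₁ , r₂ , o₁ , o₂ , r₁≢r₂ =
      no-exchange (out-clique v~x o₁ o₂ r₁≢r₂) λ y∈ y≢x → r~ o₁ y∈ y≢x , r~ o₂ y∈ y≢x
      where
      v~x = K-clique v∈ x∈ (≢-sym x≢v)

      opposite : ∀ {x′} → x′ ∈ K → x′ ≢ v → sd v x′ ≡ sd v x → ∀ {y} → y ∈ K → y ≢ x′ → sd x′ y ≡ sd x′ v
      opposite {x′} x′∈ x′≢v same {y} y∈ y≢x′ with sd x′ y Bool.≟ sd x′ v
      ... | yes eq = eq
      -- The pair now separated is `y` and `v`, at `x′`. By `one-separates` the side of `y` at `x′`
      -- is contained in the side of `x` at `v`, and it lacks `x′`.
      ... | no neq = ⊥-elim (not-split m (L ∖ x′)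
              (≤-trans (length-∖-< (side⊆L x′∈ x′≢v same)) L≤m)
              x′∈ y∈ v∈ y≢x′ (≢-sym x′≢v) neq
              λ z∈ z≢x′ eq → ∈-∖⁺ (side⊆L z∈ (off-v eq) (trans (on-x z∈ z≢x′ eq) same)) z≢x′)
        where
        off-v : ∀ {z} → sd x′ z ≡ sd x′ y → z ≢ v
        off-v eq refl = neq (sym eq)
        on-x : ∀ {z} → z ∈ K → z ≢ x′ → sd x′ z ≡ sd x′ y → sd v z ≡ sd v x′
        on-x {z} z∈ z≢x′ eq with sd v z Bool.≟ sd v x′
        ... | yes e = e
        ... | no ne = ⊥-elim (one-separates v∈ x′∈ z∈ (≢-sym x′≢v) (≢-sym (off-v eq)) (≢-sym z≢x′)
                                (≢-sym ne) λ e → neq (trans (sym eq) (sym e)))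

      unseparating : ∀ {x′} → x′ ∈ K → x′ ≢ v → sd v x′ ≡ sd v x → Unseparating x′
      unseparating x′∈ x′≢v same y∈ z∈ y≢ z≢ =
        trans (opposite x′∈ x′≢v same y∈ y≢) (sym (opposite x′∈ x′≢v same z∈ z≢))

      r~ : ∀ {r} → Out v x r → ∀ {y} → y ∈ K → y ≢ x → r ~ y
      r~ {r} o@(v~r , r≢x , x≁r) {y} y∈ y≢x with y ≟ v
      ... | yes refl = ~-sym v~r
      ... | no y≢v with sd v y Bool.≟ sd v x
      ...   | yes same = ⊥-elim (unseparating-pair v∈ x∈ y∈ u∈ x≢v y≢v u≢v (≢-sym y≢x) (sym same) v-sep
                                   (unseparating x∈ x≢v refl) (unseparating y∈ y≢v same))
      ...   | no diff = same-side v~r (K-clique v∈ y∈ (≢-sym y≢v)) (λ { refl → x≁r (K-clique x∈ y∈ (≢-sym y≢x)) })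
                          (both-differ (out-side v~x o) diff)

    all-unseparating : ∀ {v} → v ∈ K → Unseparating v
    all-unseparating {v} v∈ {x} {u} x∈ u∈ x≢v u≢v with sd v x Bool.≟ sd v u
    ... | yes eq = eq
    ... | no neq = ⊥-elim (not-split (suc (length K)) K ≤-refl v∈ x∈ u∈ x≢v u≢v neq λ y∈ _ _ → y∈)

    -- Nonadjacent `y` and `z` would be on opposite sides at `v`. As K - v lies on one side, one of
    -- them would be complete to `K` and extend it.
    outer-clique : ∀ {v y z} → v ∈ K → y ∉ K → z ∉ K → v ~ y → v ~ z → y ≢ z → y ~ z
    outer-clique {v} {y} {z} v∈ y∉ z∉ v~y v~z y≢z with y ~? z
    ... | yes y~z = y~z
    ... | no  y≁z = ⊥-elim (no-extension y~)
      where
      extends-z : ∀ {u} → u ∈ K → u ≢ v → sd v z ≡ sd v u → ∀ {w} → w ∈ K → z ~ w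
      extends-z u∈ u≢v eq {w} w∈ with w ≟ v
      ... | yes refl = ~-sym v~z
      ... | no w≢v = same-side v~z (K-clique v∈ w∈ (≢-sym w≢v)) (λ { refl → z∉ w∈ })
                       (trans eq (all-unseparating v∈ u∈ w∈ u≢v w≢v))
      y~ : ∀ {u} → u ∈ K → y ~ u
      y~ {u} u∈ with y ~? u
      ... | yes y~u = y~u
      ... | no y≁u = ⊥-elim (no-extension (extends-z u∈ u≢v (both-differ
              (≢-sym (separated v~y v~z y≢z y≁z))
              (≢-sym (separated v~y (K-clique v∈ u∈ (≢-sym u≢v)) (λ { refl → y∉ u∈ }) y≁u)))))
        where
        u≢v : u ≢ v
        u≢v refl = y≁u (~-sym v~y)

    -- Otherwise `p` and `q` are twins: `Out p q` and `Out q p` avoid `K`, so `outer-clique` joins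
    -- them to `x`, and at `x` they lie opposite the common side of `p` and `q`.
    outer-separates : ∀ {x p q} → x ∉ K → p ∈ K → q ∈ K → p ≢ q → p ~ x → q ~ x → sd x p ≢ sd x q
    outer-separates {x} {p} {q} x∉ p∈ q∈ p≢q p~x q~x same = no-twins p~q twin
      where
      p~q = K-clique p∈ q∈ p≢q
      out-x : ∀ {a b f} → a ∈ K → b ∈ K → a ~ x → b ~ x → Out a b f → x ~ f
      out-x a∈ b∈ a~x b~x (a~f , f≢b , b≁f) =
        outer-clique a∈ x∉ (λ f∈ → b≁f (K-clique b∈ f∈ (≢-sym f≢b))) a~x a~f (λ { refl → b≁f b~x })
      twin : Twin p q
      twin {f} {g} of og = same-side x~f x~g (out-out-≢ of og) (both-differ
        (separated x~f (~-sym q~x) (proj₁ (proj₂ of)) (≁-sym (proj₂ (proj₂ of))))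
        (subst (λ s → sd x g ≢ s) same
          (separated x~g (~-sym p~x) (proj₁ (proj₂ og)) (≁-sym (proj₂ (proj₂ og))))))
        where
        x~f = out-x p∈ q∈ p~x q~x of
        x~g = out-x q∈ p∈ q~x p~x og

    -- Vizing's fan argument in a maximum clique.

    -- α stands for a colour missing on K; State records that it stays missing while the hole moves.
    module Fan (c₀ : Colouring) (α : Fin k) (f : V → Fin k)
      (f-outer : ∀ {a x} → a ∈ K → x ∉ K → a ~ x → c₀ x ≢ f a)
      (f-self  : ∀ {a} → a ∈ K → c₀ a ≢ f a)
      (outer-proper : ∀ {x y} → x ∉ K → y ∉ K → x ~ y → c₀ x ≢ c₀ y)
      where

      off-K : ∀ {a x} → a ∈ K → x ∉ K → x ≢ a
      off-K a∈ x∉ refl = x∉ a∈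

      record State (h : V) (c : Colouring) : Set where
        field
          hole∈  : h ∈ K
          proper : ProperOff h c
          outer  : ∀ {x} → x ∉ K → c x ≡ c₀ x
          α-free : ∀ {x} → x ∈ K → x ≢ h → c x ≢ α
      open State

      α-outer : ∀ {h c} → State h c → ∃ λ x → x ∉ K × h ~ x × c₀ x ≡ α
      α-outer {h} {c} st with sees (proper st) α
      ... | x , h~x , cx = x , x∉ , h~x , trans (sym (outer st x∉)) cx
        where
        x∉ : x ∉ K
        x∉ x∈ = α-free st x∈ (≢-sym (~⇒≢ h~x)) cx

      -- The hole sees the colour `f h` only at `t`: outside `K` by the choice of `f`, inside
      -- because `K` is a clique.
      advance : ∀ {h c t} → State h c → t ∈ K → t ≢ h → c t ≡ f h → State t (c [ h ≔ c t ])
      advance {h} {c} {t} st t∈ t≢h ct = record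
        { hole∈ = t∈
        ; proper = shift (proper st) unique
        ; outer = λ x∉ → trans (≔-other c (c t) (off-K (hole∈ st) x∉)) (outer st x∉)
        ; α-free = free
        }
        where
        unique : ∀ {x} → h ~ x → c x ≡ c t → x ≡ t
        unique {x} h~x eq with x ∈? K | x ≟ t
        ... | _      | yes x≡t = x≡t
        ... | no x∉  | no _    = ⊥-elim (f-outer (hole∈ st) x∉ h~x (trans (sym (outer st x∉)) (trans eq ct)))
        ... | yes x∈ | no x≢t  = ⊥-elim (proper st (≢-sym (~⇒≢ h~x)) t≢h (K-clique x∈ t∈ x≢t) eq)
        free : ∀ {x} → x ∈ K → x ≢ t → (c [ h ≔ c t ]) x ≢ α
        free {x} x∈ x≢t with x ≟ h
        ... | yes _  = α-free st t∈ t≢h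
        ... | no x≢h = α-free st x∈ x≢h

      -- Kempe chains, restricted to V ∖ K

      Link : Fin k → V → V → Set
      Link β x y = x ∉ K × y ∉ K × x ~ y × (c₀ x ≡ α × c₀ y ≡ β ⊎ c₀ x ≡ β × c₀ y ≡ α)

      link-sym : ∀ {β x y} → Link β x y → Link β y x
      link-sym (x∉ , y∉ , x~y , inj₁ (cx , cy)) = y∉ , x∉ , ~-sym x~y , inj₂ (cy , cx)
      link-sym (x∉ , y∉ , x~y , inj₂ (cx , cy)) = y∉ , x∉ , ~-sym x~y , inj₁ (cy , cx)

      chain-colour : ∀ {β x y} → x ∉ K → c₀ x ≡ α → Star (Link β) x y → y ∉ K × (c₀ y ≡ α ⊎ c₀ y ≡ β)
      chain-colour x∉ cx ε = x∉ , inj₁ cx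
      chain-colour x∉ cx ((_ , y∉ , _ , inj₁ (_ , cy)) ◅ ls) = go y∉ cy ls
        where
        go : ∀ {β x y} → x ∉ K → c₀ x ≡ β → Star (Link β) x y → y ∉ K × (c₀ y ≡ α ⊎ c₀ y ≡ β)
        go x∉ cx ε = x∉ , inj₂ cx
        go x∉ cx ((_ , y∉ , _ , inj₁ (_ , cy)) ◅ ls) = go y∉ cy ls
        go x∉ cx ((_ , y∉ , _ , inj₂ (_ , cy)) ◅ ls) = chain-colour y∉ cy ls
      chain-colour x∉ cx ((_ , y∉ , _ , inj₂ (_ , cy)) ◅ ls) = chain-colour y∉ cy ls

      -- Otherwise exchange α and β on t and on the chain of e, and give β to the hole h.
      kempe : ∀ {h c t e b β} → State h c → t ∈ K → t ≢ h → c t ≡ β →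
        (∀ {x} → x ∉ K → h ~ x → c₀ x ≢ β) →
        e ∉ K → t ~ e → c₀ e ≡ α → b ∉ K → h ~ b → c₀ b ≡ α → ¬ ¬ Star (Link β) e b
      kempe {h} {c} {t} {e} {b} {β} st t∈ t≢h ct h-free e∉ t~e ce b∉ h~b cb ¬chain =
        ¬¬-finite (λ x → ¬¬-dec {Star (Link β) e x}) recolour
        where
        α≢β : α ≢ β
        α≢β α≡β = α-free st t∈ t≢h (trans ct (sym α≡β))

        off-h : ∀ {x} → x ∉ K → x ≢ h
        off-h = off-K (hole∈ st)

        data Kind (x : V) : Set where
          is-t   : x ≡ t → Kind x
          is-h   : x ≡ h → Kind x
          chainα : Star (Link β) e x → x ∉ K → c x ≡ α → Kind x
          chainβ : Star (Link β) e x → x ∉ K → c x ≡ β → Kind x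
          other  : ¬ Star (Link β) e x → x ≢ t → x ≢ h → Kind x

        new : ∀ {x} → Kind x → Fin k
        new (is-t _)       = α
        new (is-h _)       = β
        new (chainα _ _ _) = β
        new (chainβ _ _ _) = α
        new {x} (other _ _ _) = c x

        kind : ∀ {x} → Dec (Star (Link β) e x) → Kind x
        kind {x} (yes s) with chain-colour e∉ ce s
        ... | x∉ , inj₁ cx = chainα s x∉ (trans (outer st x∉) cx)
        ... | x∉ , inj₂ cx = chainβ s x∉ (trans (outer st x∉) cx)
        kind {x} (no ¬s) with x ≟ t | x ≟ h
        ... | yes x≡t | _       = is-t x≡t
        ... | no _    | yes x≡h = is-h x≡h
        ... | no x≢t  | no x≢h  = other ¬s x≢t x≢h

        only-β : ∀ {y} → y ∈ K → y ≢ h → y ≢ t → c y ≢ β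
        only-β y∈ y≢h y≢t cy = proper st y≢h t≢h (K-clique y∈ t∈ y≢t) (trans cy (sym ct))

        t-chainβ : ∀ {y} → t ~ y → y ∉ K → c y ≢ β
        t-chainβ t~y y∉ cy = proper st t≢h (off-h y∉) t~y (trans ct (sym cy))

        -- By `outer-clique`, `e` is the only neighbour of `t` outside `K` coloured α; `b` plays the
        -- same role for the hole in `h-chainα`.
        t-other : ∀ {y} → t ~ y → ¬ Star (Link β) e y → y ≢ h → c y ≢ α
        t-other {y} t~y ¬s y≢h cy with y ∈? K
        ... | yes y∈ = α-free st y∈ y≢h cy
        ... | no y∉ with e ≟ y
        ...   | yes refl = ¬s ε
        ...   | no e≢y   = outer-proper e∉ y∉ (outer-clique t∈ e∉ y∉ t~e t~y e≢y)
                             (trans ce (trans (sym cy) (outer st y∉)))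

        h-chainα : ∀ {y} → h ~ y → Star (Link β) e y → y ∉ K → c y ≢ α
        h-chainα {y} h~y s y∉ cy with b ≟ y
        ... | yes refl = ¬chain s
        ... | no b≢y   = outer-proper b∉ y∉ (outer-clique (hole∈ st) b∉ y∉ h~b h~y b≢y)
                           (trans cb (trans (sym cy) (outer st y∉)))

        h-other : ∀ {y} → h ~ y → y ≢ t → y ≢ h → c y ≢ β
        h-other {y} h~y y≢t y≢h cy with y ∈? K
        ... | yes y∈ = only-β y∈ y≢h y≢t cy
        ... | no y∉  = h-free y∉ h~y (trans (sym (outer st y∉)) cy)

        chainα-other : ∀ {x y} → x ~ y → Star (Link β) e x → x ∉ K → c x ≡ α →
                       ¬ Star (Link β) e y → y ≢ t → y ≢ h → c y ≢ β
        chainα-other {x} {y} x~y s x∉ cx ¬s y≢t y≢h cy with y ∈? K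
        ... | yes y∈ = only-β y∈ y≢h y≢t cy
        ... | no y∉  = ¬s (s ◅◅ (x∉ , y∉ , x~y ,
                         inj₁ (trans (sym (outer st x∉)) cx , trans (sym (outer st y∉)) cy)) ◅ ε)

        chainβ-other : ∀ {x y} → x ~ y → Star (Link β) e x → x ∉ K → c x ≡ β →
                       ¬ Star (Link β) e y → y ≢ h → c y ≢ α
        chainβ-other {x} {y} x~y s x∉ cx ¬s y≢h cy with y ∈? K
        ... | yes y∈ = α-free st y∈ y≢h cy
        ... | no y∉  = ¬s (s ◅◅ (x∉ , y∉ , x~y ,
                         inj₂ (trans (sym (outer st x∉)) cx , trans (sym (outer st y∉)) cy)) ◅ ε)

        same : ∀ {x y γ} → x ≢ h → y ≢ h → x ~ y → c x ≡ γ → c y ≡ γ → ⊥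
        same x≢h y≢h x~y cx cy = proper st x≢h y≢h x~y (trans cx (sym cy))

        differ : ∀ {x y} (p : Kind x) (q : Kind y) → x ~ y → new p ≢ new q
        differ (is-t refl) (is-t refl) x~y _ = ~⇒≢ x~y refl
        differ (is-t refl) (is-h refl) x~y = α≢β
        differ (is-t refl) (chainα _ _ _) x~y = α≢β
        differ (is-t refl) (chainβ _ y∉ cy) x~y _ = t-chainβ x~y y∉ cy
        differ (is-t refl) (other ¬s _ y≢h) x~y = ≢-sym (t-other x~y ¬s y≢h)
        differ (is-h refl) (is-t refl) x~y = ≢-sym α≢β
        differ (is-h refl) (is-h refl) x~y _ = ~⇒≢ x~y refl
        differ (is-h refl) (chainα s y∉ cy) x~y _ = h-chainα x~y s y∉ cy
        differ (is-h refl) (chainβ _ _ _) x~y = ≢-sym α≢β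
        differ (is-h refl) (other _ y≢t y≢h) x~y = ≢-sym (h-other x~y y≢t y≢h)
        differ (chainα _ _ _) (is-t refl) x~y = ≢-sym α≢β
        differ (chainα s x∉ cx) (is-h refl) x~y _ = h-chainα (~-sym x~y) s x∉ cx
        differ (chainα _ x∉ cx) (chainα _ y∉ cy) x~y _ = same (off-h x∉) (off-h y∉) x~y cx cy
        differ (chainα _ _ _) (chainβ _ _ _) x~y = ≢-sym α≢β
        differ (chainα s x∉ cx) (other ¬s y≢t y≢h) x~y = ≢-sym (chainα-other x~y s x∉ cx ¬s y≢t y≢h)
        differ (chainβ _ x∉ cx) (is-t refl) x~y _ = t-chainβ (~-sym x~y) x∉ cx
        differ (chainβ _ _ _) (is-h refl) x~y = α≢β
        differ (chainβ _ _ _) (chainα _ _ _) x~y = α≢β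
        differ (chainβ _ x∉ cx) (chainβ _ y∉ cy) x~y _ = same (off-h x∉) (off-h y∉) x~y cx cy
        differ (chainβ s x∉ cx) (other ¬s _ y≢h) x~y = ≢-sym (chainβ-other x~y s x∉ cx ¬s y≢h)
        differ (other ¬s _ x≢h) (is-t refl) x~y = t-other (~-sym x~y) ¬s x≢h
        differ (other _ x≢t x≢h) (is-h refl) x~y = h-other (~-sym x~y) x≢t x≢h
        differ (other ¬s x≢t x≢h) (chainα s y∉ cy) x~y = chainα-other (~-sym x~y) s y∉ cy ¬s x≢t x≢h
        differ (other ¬s _ x≢h) (chainβ s y∉ cy) x~y = chainβ-other (~-sym x~y) s y∉ cy ¬s x≢h
        differ (other _ _ x≢h) (other _ _ y≢h) x~y = proper st x≢h y≢h x~y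

        recolour : ¬ (∀ x → Dec (Star (Link β) e x))
        recolour dec = uncolourable (λ x → new (kind (dec x))) λ x y → differ (kind (dec x)) (kind (dec y))

      -- A snapshot of the moment when the hole was at `s` and about to move to `target`. That
      -- `target` still had its initial colour keeps it distinct from a later hole with the same
      -- missing colour.
      record Record (s : V) : Set where
        field
          {colouring} : Colouring
          {target}    : V
          state       : State s colouring
          target∈     : target ∈ K
          target≢     : target ≢ s
          target-now  : colouring target ≡ f s
          target-then : c₀ target ≡ f s

      -- Two fan vertices s, w with the same missing colour β: the α-coloured neighbours outside K of
      -- t, s and w are three ends of one αβ-chain.
      collision : ∀ {w c s} → State w c → s ∈ K → s ≢ w → c s ≡ f s → f s ≡ f w → ¬ Record s
      collision {w} {c} {s} stw s∈ s≢w cs fs≡fw record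
        { colouring = c′ ; target = t ; state = sts ; target∈ = t∈ ; target≢ = t≢s
        ; target-now = c′t ; target-then = c₀t }
        -- Moving the recorded hole on to `t` shows that `t` also has a neighbour coloured α outside
        -- `K`.
        with α-outer (advance sts t∈ t≢s c′t) | α-outer sts | α-outer stw
      ... | e , e∉ , t~e , ce | b , b∉ , s~b , cb | b′ , b′∉ , w~b′ , cb′ =
        kempe sts t∈ t≢s c′t (λ x∉ → f-outer s∈ x∉) e∉ t~e ce b∉ s~b cb λ eb →
        kempe stw s∈ s≢w cs (λ x∉ w~x cx → f-outer w∈ x∉ w~x (trans cx fs≡fw)) b∉ s~b cb b′∉ w~b′ cb′ λ bb′ →
        contradict eb bb′
        where
        β : Fin k
        β = f s

        w∈ = hole∈ stw

        α≢β : α ≢ β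
        α≢β α≡β = α-free stw s∈ s≢w (trans cs (sym α≡β))

        t≢w : t ≢ w
        t≢w refl = f-self w∈ (trans c₀t fs≡fw)

        link-β : ∀ {x y} → c₀ x ≡ α → Link β x y → c₀ y ≡ β
        link-β cx (_ , _ , _ , inj₁ (_ , cy))  = cy
        link-β cx (_ , _ , _ , inj₂ (cx′ , _)) = ⊥-elim (α≢β (trans (sym cx) cx′))

        link-same : ∀ {x y z} → Link β x y → Link β x z → c₀ y ≡ c₀ z
        link-same (_ , _ , _ , inj₁ (_ , cy))  (_ , _ , _ , inj₁ (_ , cz))  = trans cy (sym cz)
        link-same (_ , _ , _ , inj₁ (cx , _))  (_ , _ , _ , inj₂ (cx′ , _)) = ⊥-elim (α≢β (trans (sym cx) cx′))
        link-same (_ , _ , _ , inj₂ (cx , _))  (_ , _ , _ , inj₁ (cx′ , _)) = ⊥-elim (α≢β (trans (sym cx′) cx))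
        link-same (_ , _ , _ , inj₂ (_ , cy))  (_ , _ , _ , inj₂ (_ , cz))  = trans cy (sym cz)

        links-≁ : ∀ {x y z} → Link β x y → Link β x z → y ≁ z
        links-≁ l@(_ , y∉ , _) l′@(_ , z∉ , _) y~z = outer-proper y∉ z∉ y~z (link-same l l′)

        -- Vertices linked to `x` have equal colours, hence are pairwise nonadjacent; three of them
        -- would form a claw.
        two-links : ∀ {x y z z′} → Link β x y → Link β x z → Link β x z′ → z ≢ y → z′ ≢ y → z ≡ z′
        two-links {x} {y} {z} {z′} l₁@(_ , _ , x~y , _) l₂@(_ , _ , x~z , _) l₃@(_ , _ , x~z′ , _) z≢y z′≢y
          with z ≟ z′
        ... | yes eq = eq
        ... | no z≢z′ = ⊥-elim (links-≁ l₂ l₃ (same-side x~z x~z′ z≢z′ (both-differ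
                (separated x~z x~y z≢y (links-≁ l₂ l₁)) (separated x~z′ x~y z′≢y (links-≁ l₃ l₁)))))

        open Trail (Link β) link-sym two-links

        Avoids : V → V → Set
        Avoids a x = ∀ {y} → Link β x y → a ≁ y

        -- Two links at `x` together with `a` would form a claw.
        is-end : ∀ {a x} → a ∈ K → a ~ x → Avoids a x → End x
        is-end {a} {x} a∈ a~x av {y} {z} l@(_ , y∉ , x~y , _) l′@(_ , z∉ , x~z , _) with y ≟ z
        ... | yes eq = eq
        ... | no y≢z = ⊥-elim (links-≁ l l′ (same-side x~y x~z y≢z (both-differ
                (separated x~y (~-sym a~x) (off-K a∈ y∉) (≁-sym (av l)))
                (separated x~z (~-sym a~x) (off-K a∈ z∉) (≁-sym (av l′))))))

        -- By `outer-separates`, `p` and `q` occupy both sides at `x`, and a link would have to lie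
        -- opposite each.
        isolated : ∀ {p q x} → x ∉ K → p ∈ K → q ∈ K → p ≢ q → p ~ x → q ~ x →
                   Avoids p x → Avoids q x → ∀ {y} → Star (Link β) x y → x ≡ y
        isolated _ _ _ _ _ _ _ _ ε = refl
        isolated x∉ p∈ q∈ p≢q p~x q~x avp avq (l@(_ , y∉ , x~y , _) ◅ _) =
          ⊥-elim (outer-separates x∉ p∈ q∈ p≢q p~x q~x (both-differ
            (≢-sym (separated x~y (~-sym p~x) (off-K p∈ y∉) (≁-sym (avp l))))
            (≢-sym (separated x~y (~-sym q~x) (off-K q∈ y∉) (≁-sym (avq l))))))

        not-three : ∀ {x} → x ∉ K → t ~ x → s ~ x → w ~ x → ⊥
        not-three x∉ t~x s~x w~x = outer-separates x∉ t∈ s∈ t≢s t~x s~x (both-differ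
          (outer-separates x∉ t∈ w∈ t≢w t~x w~x) (outer-separates x∉ s∈ w∈ s≢w s~x w~x))

        avoid-t : ∀ {x} → c₀ x ≡ α → Avoids t x
        avoid-t cx l@(_ , y∉ , _) t~y =
          proper sts t≢s (off-K s∈ y∉) t~y (trans c′t (trans (sym (link-β cx l)) (sym (outer sts y∉))))

        avoid-s : ∀ {x} → c₀ x ≡ α → Avoids s x
        avoid-s cx l@(_ , y∉ , _) s~y = f-outer s∈ y∉ s~y (link-β cx l)

        avoid-w : ∀ {x} → c₀ x ≡ α → Avoids w x
        avoid-w cx l@(_ , y∉ , _) w~y = f-outer w∈ y∉ w~y (trans (link-β cx l) fs≡fw)

        -- If two of the three ends coincide, that vertex is isolated in its chain. The third end
        -- then equals it too, and it has three neighbours in `K`.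
        contradict : Star (Link β) e b → Star (Link β) b b′ → ⊥
        contradict eb bb′ with e ≟ b | e ≟ b′ | b ≟ b′
        ... | yes refl | _ | _
          with isolated e∉ t∈ s∈ t≢s t~e s~b (avoid-t ce) (avoid-s ce) bb′
        ...   | refl = not-three e∉ t~e s~b w~b′
        contradict eb bb′ | no _ | yes refl | _
          with isolated e∉ t∈ w∈ t≢w t~e w~b′ (avoid-t ce) (avoid-w ce) eb
        ...   | refl = not-three e∉ t~e s~b w~b′
        contradict eb bb′ | no _ | no _ | yes refl
          with isolated b∉ s∈ w∈ s≢w s~b w~b′ (avoid-s cb) (avoid-w cb) (Star.reverse link-sym eb)
        ...   | refl = not-three e∉ t~e s~b w~b′
        contradict eb bb′ | no e≢b | no e≢b′ | no b≢b′ =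
          no-three-ends (is-end t∈ t~e (avoid-t ce)) (is-end s∈ s~b (avoid-s cb))
            (is-end w∈ w~b′ (avoid-w cb′)) e≢b e≢b′ b≢b′ eb (eb ◅◅ bb′)

      -- The hole moves to the vertex of `K` coloured `f h`, and `m` bounds the remaining moves.
      -- Reaching a visited `t` gives f t = c t = f h, which is a `collision`. Unvisited vertices
      -- keep their initial colours, which supplies `target-then`.
      fan : ∀ m {h c} vis → length K < m + length vis → Unique vis → (∀ {a} → a ∈ vis → a ∈ K) →
        State h c → h ∉ vis → (∀ {a} → a ∈ vis → c a ≡ f a × Record a) →
        (∀ {a} → a ∈ K → a ∉ vis → a ≢ h → c a ≡ c₀ a) → ⊥
      fan zero vis K<vis u vis⊆K _ _ _ _ =
        <⇒≱ K<vis (K-max vis u λ x∈ y∈ → K-clique (vis⊆K x∈) (vis⊆K y∈))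
      fan (suc m) {h} {c} vis bound u vis⊆K st h∉ history same with sees (proper st) (f h)
      ... | t , h~t , ct with t ∈? K
      ... | no t∉ = f-outer (hole∈ st) t∉ h~t (trans (sym (outer st t∉)) ct)
      ... | yes t∈ with t ∈? vis
      ... | yes t∈vis = collision st t∈ (≢-sym (~⇒≢ h~t)) (proj₁ (history t∈vis))
                          (trans (sym (proj₁ (history t∈vis))) ct) (proj₂ (history t∈vis))
      ... | no t∉vis = fan m (h ∷ vis) (subst (length K <_) (sym (+-suc m (length vis))) bound)
          (All.tabulate (λ a∈ → λ { refl → h∉ a∈ }) ∷ u)
          (λ { (here refl) → hole∈ st ; (there a∈) → vis⊆K a∈ })
          (advance st t∈ t≢h ct) t∉ history′ same′
        where
        t≢h = ≢-sym (~⇒≢ h~t)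
        t∉ : t ∉ h ∷ vis
        t∉ (here t≡h) = t≢h t≡h
        t∉ (there t∈) = t∉vis t∈
        history′ : ∀ {a} → a ∈ h ∷ vis → (c [ h ≔ c t ]) a ≡ f a × Record a
        history′ (here refl) = trans (≔-same c h (c t)) ct , record
          { state = st ; target∈ = t∈ ; target≢ = t≢h ; target-now = ct
          ; target-then = trans (sym (same t∈ t∉vis t≢h)) ct }
        history′ {a} (there a∈) = trans (≔-other c (c t) λ { refl → h∉ a∈ }) (proj₁ (history a∈)) ,
                                  proj₂ (history a∈)
        same′ : ∀ {a} → a ∈ K → a ∉ h ∷ vis → a ≢ t → (c [ h ≔ c t ]) a ≡ c₀ a
        same′ a∈ a∉ a≢t = trans (≔-other c (c t) (a∉ ∘ here)) (same a∈ (a∉ ∘ there) (a∉ ∘ here))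

    -- Initial data for the fan.

    module _ {v₀ : V} (v₀∈ : v₀ ∈ K) where

      c₀ : Colouring
      c₀ = proj₁ (colouring-off v₀)

      c₀-proper : ProperOff v₀ c₀
      c₀-proper = proj₂ (colouring-off v₀)

      outer : V → List V
      outer a = filter (λ x → (a ~? x) ×-dec ¬? (x ∈? K)) (allFin n)

      ∈-outer : ∀ {a x} → a ~ x → x ∉ K → x ∈ outer a
      ∈-outer {a} {x} a~x x∉ = ∈-filter⁺ (λ x → (a ~? x) ×-dec ¬? (x ∈? K)) (∈-allFin x) (a~x , x∉)

      outer-∈ : ∀ {a x} → x ∈ outer a → a ~ x × x ∉ K
      outer-∈ {a} x∈ = proj₂ (∈-filter⁻ (λ x → (a ~? x) ×-dec ¬? (x ∈? K)) {xs = allFin n} x∈)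

      outer-length : ∀ {a} → a ∈ K → length (a ∷ outer a) ≤ 2 + d
      outer-length {a} a∈ = clique-length
        (unique-∷ (Unique.filter⁺ (λ x → (a ~? x) ×-dec ¬? (x ∈? K)) (Unique.allFin⁺ n)) (proj₁ ∘ outer-∈))
        (clique-∷ (λ x∈ y∈ → outer-clique a∈ (proj₂ (outer-∈ x∈)) (proj₂ (outer-∈ y∈))
                                            (proj₁ (outer-∈ x∈)) (proj₁ (outer-∈ y∈)))
                  (proj₁ ∘ outer-∈))

      -- By `outer-clique`, `a` and its neighbours outside `K` form a clique; its at most d + 2
      -- vertices leave one colour over.
      missing-outer : ∀ a → ∃ λ γ → a ∈ K → γ ∉ map c₀ (a ∷ outer a)
      missing-outer a with a ∈? K
      ... | no a∉ = zero , λ a∈ → ⊥-elim (a∉ a∈)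
      ... | yes a∈ with missing-element (map c₀ (a ∷ outer a))
                          (s≤s (subst (_≤ 2 + d) (sym (length-map c₀ (a ∷ outer a))) (outer-length a∈)))
      ...   | γ , γ∉ = γ , λ _ → γ∉

      contradiction : ⊥
      contradiction with missing-element (map c₀ K)
        (s≤s (subst (_≤ 2 + d) (sym (length-map c₀ K)) (clique-length K-unique K-clique)))
      ... | α , α∉ = Fan.fan c₀ α (proj₁ ∘ missing-outer)
          (λ {a} a∈ x∉ a~x eq → proj₂ (missing-outer a) a∈
            (there (subst (_∈ map c₀ (outer a)) eq (∈-map⁺ c₀ (∈-outer a~x x∉)))))
          (λ {a} a∈ eq → proj₂ (missing-outer a) a∈ (here (sym eq)))
          (λ x∉ y∉ → c₀-proper (λ { refl → x∉ v₀∈ }) (λ { refl → y∉ v₀∈ }))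
          (suc (length K)) [] (m≤m+n (suc (length K)) 0) [] (λ ())
          (record { hole∈ = v₀∈ ; proper = c₀-proper ; outer = λ _ → refl
                  ; α-free = λ x∈ _ eq → α∉ (subst (_∈ map c₀ K) eq (∈-map⁺ c₀ x∈)) })
          (λ ()) (λ ()) (λ _ _ _ → refl)

  -- Cliques have at most d + 2 vertices, so enlarging a clique as long as possible terminates.
  no-cliques : ∀ m {v L} → 2 + d < m + length L → v ∈ L → Unique L → ¬ Clique L
  no-cliques zero    bound _ u cl = <⇒≱ bound (clique-length u cl)
  no-cliques (suc m) {v} {L} bound v∈ u cl = MaximumClique.contradiction L u cl max v∈
    where
    max : ∀ L′ → Unique L′ → Clique L′ → length L′ ≤ length L
    max L′ u′ cl′ with length L′ ≤? length L
    ... | yes le = le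
    max [] _ _ | no _ = z≤n
    max L′@(_ ∷ _) u′ cl′ | no ≰ = ⊥-elim (no-cliques m
              (≤-trans bound (subst (_≤ m + length L′) (+-suc m (length L)) (+-monoʳ-≤ m (≰⇒> ≰)))) (here refl) u′ cl′)

  no-vertex : ¬ V
  no-vertex v = no-cliques (3 + d) {v} {v ∷ []} (m≤m+n (3 + d) 1) (here refl) ([] ∷ [])
    λ { (here refl) (here refl) v≢v → ⊥-elim (v≢v refl) }

-- Deciding colourability, and induction on the number of vertices.

-- Respect for pointwise equality stands in for function extensionality.
any-function? : ∀ {k} n {P : (Fin n → Fin k) → Set} → (∀ {f g} → (∀ i → f i ≡ g i) → P f → P g) →
                (∀ f → Dec (P f)) → Dec (∃ P)
any-function? {k} zero resp P? = map′ (none ,_) (λ (f , p) → resp (λ ()) p) (P? none)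
  where
  none : Fin 0 → Fin k
  none ()
any-function? {k} (suc n) {P} resp P? = map′
  (λ (a , f , p) → cons a f , p)
  (λ (f , p) → f zero , f ∘ suc , resp (λ { zero → refl ; (suc i) → refl }) p)
  (any? λ a → any-function? n (λ f≗g → resp λ { zero → refl ; (suc i) → f≗g i }) (P? ∘ cons a))
  where
  cons : Fin k → (Fin n → Fin k) → Fin (suc n) → Fin k
  cons a f zero    = a
  cons a f (suc i) = f i

-- Decidability lets the refutation of a critical graph yield an actual colouring.
colourable? : ∀ {n} (G : SimpleGraph n) k → Dec (χ≤ G k)
colourable? {n} G k = any-function? n
  (λ f≗g pf u v u~v eq → pf u v u~v (trans (f≗g u) (trans eq (sym (f≗g v)))))
  λ c → all? λ u → all? λ v → (adj G u v Bool.≟ true) →-dec ¬? (c u ≟ c v)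

_─_ : ∀ {n} → SimpleGraph (suc n) → Fin (suc n) → SimpleGraph n
G ─ v = record
  { adj    = λ i j → adj G (punchIn v i) (punchIn v j)
  ; symm   = λ i j → symm G (punchIn v i) (punchIn v j)
  ; irrefl = λ i → irrefl G (punchIn v i)
  }

extend-colouring : ∀ {n k} (G : SimpleGraph (suc n)) v → χ≤ (G ─ v) (suc k) →
  Σ (Fin (suc n) → Fin (suc k)) λ c → ∀ {x y} → x ≢ v → y ≢ v → Adj G x y → c x ≢ c y
extend-colouring {n} {k} G v (c , c-proper) = ĉ , proper
  where
  ĉ : Fin (suc n) → Fin (suc k)
  ĉ x with v ≟ x
  -- A placeholder at the hole.
  ... | yes _  = zero
  ... | no v≢x = c (punchOut v≢x)
  proper : ∀ {x y} → x ≢ v → y ≢ v → Adj G x y → ĉ x ≢ ĉ y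
  proper {x} {y} x≢v y≢v x~y with v ≟ x | v ≟ y
  ... | yes v≡x | _       = ⊥-elim (x≢v (sym v≡x))
  ... | no _    | yes v≡y = ⊥-elim (y≢v (sym v≡y))
  ... | no v≢x  | no v≢y  = c-proper _ _
    (trans (cong₂ (adj G) (punchIn-punchOut v≢x) (punchIn-punchOut v≢y)) x~y)

-- A fixed bound `d` and the side function both pass to induced subgraphs, so the induction
-- hypothesis colours every vertex-deleted subgraph with the same d + 3 colours.
colouring : ∀ n d (G : SimpleGraph n) (sd : Fin n → Fin n → Bool) →
  (∀ {v x y} → Adj G v x → Adj G v y → x ≢ y → sd v x ≡ sd v y → Adj G x y) →
  (∀ {u v} → u ≢ v → ∀ xs → Unique xs → All (λ w → Adj G u w × Adj G v w) xs → length xs ≤ d) →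
  χ≤ G (3 + d)
colouring zero    d G sd same-side codegree = (λ ()) , λ ()
colouring (suc n) d G sd same-side codegree with colourable? G (3 + d)
... | yes χ = χ
... | no ¬χ = ⊥-elim (Critical.no-vertex d G sd same-side codegree (λ c p → ¬χ (c , p)) off zero)
  where
  off : ∀ v → Σ (Fin (suc n) → Fin (3 + d)) λ c → ∀ {x y} → x ≢ v → y ≢ v → Adj G x y → c x ≢ c y
  off v = extend-colouring G v (colouring n d (G ─ v) (λ i j → sd (punchIn v i) (punchIn v j))
    (λ v~x v~y x≢y → same-side v~x v~y (x≢y ∘ punchIn-injective v _ _))
    (λ {a} {b} a≢b xs u common → subst (_≤ d) (length-map (punchIn v) xs)
      (codegree (a≢b ∘ punchIn-injective v a b) (map (punchIn v) xs)
        (Unique.map⁺ (λ {i} {j} → punchIn-injective v i j) u) (All.map⁺ common))))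

-- From `Δ₂` and the two cliques to the hypotheses of the induction.

∈⇒≤-max : ∀ {x xs} → x ∈ xs → x ≤ foldr _⊔_ 0 xs
∈⇒≤-max {x} {_ ∷ xs} (here refl) = m≤m⊔n x (foldr _⊔_ 0 xs)
∈⇒≤-max {x} {y ∷ xs} (there x∈)  = ≤-trans (∈⇒≤-max x∈) (m≤n⊔m y (foldr _⊔_ 0 xs))

codeg≤Δ₂ : ∀ {n} (G : SimpleGraph n) {u v} → u ≢ v → codeg G u v ≤ Δ₂ G
codeg≤Δ₂ {n} G {u} {v} u≢v = ∈⇒≤-max (∈-concatMap⁺ row (lose (∈-allFin u)
  (subst (_∈ row u) entry-off (∈-map⁺ (entry u) (∈-allFin v)))))
  where
  entry : Fin n → Fin n → ℕ
  entry u v = if ⌊ u ≟ v ⌋ then 0 else codeg G u v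
  row : Fin n → List ℕ
  row u = map (entry u) (allFin n)
  entry-off : entry u v ≡ codeg G u v
  entry-off with u ≟ v
  ... | yes u≡v = ⊥-elim (u≢v u≡v)
  ... | no _    = refl

common≤codeg : ∀ {n} (G : SimpleGraph n) u v {xs} → Unique xs →
               All (λ w → Adj G u w × Adj G v w) xs → length xs ≤ codeg G u v
common≤codeg G u v unique common = unique-⊆-length unique λ {w} w∈ →
  ∈-filter⁺ (λ w → T? (adj G u w ∧ adj G v w)) (∈-allFin w) (both (All.lookup common w∈))
  where
  both : ∀ {a b} → a ≡ true × b ≡ true → T (a ∧ b)
  both (refl , refl) = _

theorem1p3 : ∀ (n : ℕ) (G : SimpleGraph n) → IsQuasiLine G → χ≤ G (Δ₂ G + 3)
theorem1p3 n G quasi-line = subst (χ≤ G) (+-comm 3 (Δ₂ G)) (colouring n (Δ₂ G) G side same-side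
  λ {u} {v} u≢v xs unique common → ≤-trans (common≤codeg G u v unique common) (codeg≤Δ₂ G u≢v))
  where
  side : Fin n → Fin n → Bool
  -- Membership in the first clique alone decides the side; a neighbour outside it must be in the
  -- second.
  side v x = does (x ∈ˢ? proj₁ (quasi-line v))

  same-side : ∀ {v x y} → Adj G v x → Adj G v y → x ≢ y → side v x ≡ side v y → Adj G x y
  same-side {v} {x} {y} v~x v~y x≢y eq with quasi-line v
  ... | A , B , A-clique , B-clique , cover with x ∈ˢ? A | y ∈ˢ? A
  ... | yes x∈A | yes y∈A = A-clique x y x∈A y∈A x≢y
  ... | no x∉A  | no y∉A  = B-clique x y (in-B x∉A v~x) (in-B y∉A v~y) x≢y
    where
    in-B : ∀ {z} → ¬ z ∈ˢ A → Adj G v z → z ∈ˢ B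
    in-B {z} z∉A v~z with Equivalence.to (cover z) (inj₂ v~z)
    ... | inj₁ z∈A = ⊥-elim (z∉A z∈A)
    ... | inj₂ z∈B = z∈B
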